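{- Let $k$ be a positive integer, let $\varepsilon$ be a positive real number, and let $G$ be a connected non-complete graph of even order with $t(G)\geq 1+\varepsilon$. If $\kappa(G)>\frac{(2k-2)(1+\varepsilon)}{\varepsilon}$, then $G$ is $k$-extendable.
   Context: All graphs are finite, simple and connected. The order of $G$ is $|V(G)|$, $\kappa(G)$ denotes the vertex connectivity of $G$, and $c(H)$ denotes the number of connected components of a graph $H$. For a non-complete graph $G$, the toughness is $t(G)=\min \frac{|S|}{c(G-S)}$, the minimum taken over all vertex cut-sets $S\subset V(G)$ (sets $S$ for which $G-S$ is disconnected). A matching is a set of pairwise independent (vertex-disjoint) edges; a $k$-matching is a matching with exactly $k$ edges; a perfect matching is a matching covering all vertices. A connected graph $G$ with a perfect matching and $|V(G)|\geq 2k+2$ is called $k$-extendable if every $k$-matching of $G$ is contained in a perfect matching of $G$. -}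

module Defs where

open import Data.Nat as ℕ using (ℕ; zero; suc)
import Data.Nat.Properties as ℕ
import Data.Integer as ℤ
open import Data.Rational as ℚ using (ℚ; 0ℚ; 1ℚ)
import Data.Rational.Properties as ℚ
open import Data.Rational.Solver using (module +-*-Solver)
open import Data.Bool.Base using (true; false)
open import Data.Fin as Fin using (Fin)
import Data.Fin.Properties as Fin
open import Data.Fin.Subset using (Subset; inside; outside; _∈_; _∉_; ⊤; ⊥; ∁; ⁅_⁆; _∪_; ∣_∣)
open import Data.Fin.Subset.Properties
  using (_∈?_; anySubset?; x∈⁅x⁆; x∈⁅y⁆⇒x≡y; x∈∁p⇒x∉p; x∉∁p⇒x∈p; x∈p∪q⁻; x∈p∪q⁺; ∣⊤∣≡n; ∣∁p∣≡n∸∣p∣)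
open import Data.List.Base using (List; []; _∷_; length; filter; deduplicate; allFin)
open import Data.List.Membership.Propositional using () renaming (_∈_ to _∈ˡ_)
open import Data.List.Membership.Propositional.Properties using (∈-allFin; ∈-filter⁺)
open import Data.List.Relation.Unary.All using (All)
open import Data.List.Relation.Unary.Any using (Any; here; there)
open import Data.List.Relation.Unary.AllPairs using (AllPairs)
open import Data.Product using (Σ; ∃; ∃-syntax; _×_; _,_; proj₁; proj₂)
open import Data.Sum using (_⊎_; inj₁; inj₂)
open import Data.Vec.Base using ([]; _∷_)
open import Function using (_∘_)
open import Level using (0ℓ)
open import Relation.Binary.Bundles using (DecTotalOrder)
open import Relation.Binary.Core using (Rel)
open import Relation.Binary.Definitions using (Decidable; Symmetric; Irreflexive)
open import Relation.Binary.PropositionalEquality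
open import Relation.Binary.Construct.Closure.ReflexiveTransitive using (Star; ε; _◅_; _◅◅_)
open import Relation.Nullary using (¬_; yes; no; contradiction; ¬?)
open import Relation.Nullary.Decidable using (map′; _×-dec_; _⊎-dec_; _→-dec_)
open import Relation.Unary using (Pred)
import Relation.Unary as U

------------------------------------------------------------------------
-- Real numbers, as Cauchy sequences of rationals with a modulus.
-- Distinct sequences may represent the same real.

record ℝ : Set where
  field
    seq    : ℕ → ℚ
    cauchy : ∀ δ → 0ℚ ℚ.< δ →
             ∃[ N ] ∀ m n → N ℕ.≤ m → N ℕ.≤ n → ℚ.∣ seq m ℚ.- seq n ∣ ℚ.≤ δ

open ℝ public

infix 4 _<ℝ_ _≤ℝ_

_<ℝ_ : Rel ℝ 0ℓ
x <ℝ y = ∃[ δ ] 0ℚ ℚ.< δ × ∃[ N ] ∀ n → N ℕ.≤ n → seq x n ℚ.+ δ ℚ.≤ seq y n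

_≤ℝ_ : Rel ℝ 0ℓ
x ≤ℝ y = ∀ δ → 0ℚ ℚ.< δ → ∃[ N ] ∀ n → N ℕ.≤ n → seq x n ℚ.≤ seq y n ℚ.+ δ

fromℚ : ℚ → ℝ
fromℚ q .seq _ = q
fromℚ q .cauchy δ δ>0 = 0 , λ _ _ _ _ →
  ℚ.≤-trans (ℚ.≤-reflexive (cong ℚ.∣_∣ (ℚ.+-inverseʳ q))) (ℚ.<⇒≤ δ>0)

fromℕ : ℕ → ℝ
fromℕ m = fromℚ (ℤ.+ m ℚ./ 1)

0ℝ 1ℝ : ℝ
0ℝ = fromℚ 0ℚ
1ℝ = fromℚ 1ℚ

private
  open +-*-Solver

  ring-cancel : ∀ a b → a ≡ (a ℚ.- b) ℚ.+ b
  ring-cancel = solve 2 (λ a b → a := (a :- b) :+ b) refl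

  ring-sum : ∀ a b c d → (a ℚ.+ b) ℚ.- (c ℚ.+ d) ≡ (a ℚ.- c) ℚ.+ (b ℚ.- d)
  ring-sum = solve 4 (λ a b c d → (a :+ b) :- (c :+ d) := (a :- c) :+ (b :- d)) refl

  ring-product : ∀ a b c d → a ℚ.* b ℚ.- c ℚ.* d ≡ a ℚ.* (b ℚ.- d) ℚ.+ d ℚ.* (a ℚ.- c)
  ring-product = solve 4 (λ a b c d → a :* b :- c :* d := a :* (b :- d) :+ d :* (a :- c)) refl

  ring-recip : ∀ p q s t → (p ℚ.* q) ℚ.* t ℚ.- (s ℚ.* t) ℚ.* q ≡ (p ℚ.- s) ℚ.* (t ℚ.* q)
  ring-recip = solve 4 (λ p q s t → (p :* q) :* t :- (s :* t) :* q := (p :- s) :* (t :* q)) refl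

  ring-regroup : ∀ d p q s t →
    d ℚ.* (p ℚ.* q) ℚ.* (s ℚ.* t) ≡ d ℚ.* ((p ℚ.* s) ℚ.* (q ℚ.* t))
  ring-regroup = solve 5 (λ d p q s t →
    d :* (p :* q) :* (s :* t) := d :* ((p :* s) :* (q :* t))) refl

  *-pos : ∀ p q → 0ℚ ℚ.< p → 0ℚ ℚ.< q → 0ℚ ℚ.< p ℚ.* q
  *-pos p q p>0 q>0 =
    ℚ.positive⁻¹ (p ℚ.* q) {{ℚ.pos*pos⇒pos p {{ℚ.positive p>0}} q {{ℚ.positive q>0}}}}

  *-mono : ∀ a b c d → 0ℚ ℚ.≤ a → 0ℚ ℚ.≤ d → a ℚ.≤ b → c ℚ.≤ d → a ℚ.* c ℚ.≤ b ℚ.* d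
  *-mono a b c d a≥0 d≥0 a≤b c≤d = ℚ.≤-trans
    (ℚ.*-monoˡ-≤-nonNeg a {{ℚ.nonNegative a≥0}} c≤d)
    (ℚ.*-monoʳ-≤-nonNeg d {{ℚ.nonNegative d≥0}} a≤b)

  scaleDown : ∀ d δ → 0ℚ ℚ.< d → 0ℚ ℚ.< δ → ∃[ δ′ ] 0ℚ ℚ.< δ′ × d ℚ.* δ′ ≡ δ
  scaleDown d δ d>0 δ>0 =
    ℚ.1/ d ℚ.* δ ,
    *-pos (ℚ.1/ d) δ (ℚ.positive⁻¹ (ℚ.1/ d) {{ℚ.1/pos⇒pos d {{ℚ.positive d>0}}}}) δ>0 ,
    trans (sym (ℚ.*-assoc d (ℚ.1/ d) δ))
      (trans (cong (ℚ._* δ) (ℚ.*-inverseʳ d)) (ℚ.*-identityˡ δ))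
    where
    instance
      d-nonZero : ℚ.NonZero d
      d-nonZero = ℚ.pos⇒nonZero d {{ℚ.positive d>0}}

  product-close : ∀ B C δ δ′ a b c d → 0ℚ ℚ.≤ δ′ → (B ℚ.+ C) ℚ.* δ′ ≡ δ →
    ℚ.∣ a ∣ ℚ.≤ B → ℚ.∣ d ∣ ℚ.≤ C → ℚ.∣ a ℚ.- c ∣ ℚ.≤ δ′ → ℚ.∣ b ℚ.- d ∣ ℚ.≤ δ′ →
    ℚ.∣ a ℚ.* b ℚ.- c ℚ.* d ∣ ℚ.≤ δ
  product-close B C δ δ′ a b c d δ′≥0 scaled a≤B d≤C ac bd = begin
    ℚ.∣ a ℚ.* b ℚ.- c ℚ.* d ∣
      ≡⟨ cong ℚ.∣_∣ (ring-product a b c d) ⟩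
    ℚ.∣ a ℚ.* (b ℚ.- d) ℚ.+ d ℚ.* (a ℚ.- c) ∣
      ≤⟨ ℚ.∣p+q∣≤∣p∣+∣q∣ (a ℚ.* (b ℚ.- d)) (d ℚ.* (a ℚ.- c)) ⟩
    ℚ.∣ a ℚ.* (b ℚ.- d) ∣ ℚ.+ ℚ.∣ d ℚ.* (a ℚ.- c) ∣
      ≡⟨ cong₂ ℚ._+_ (ℚ.∣p*q∣≡∣p∣*∣q∣ a (b ℚ.- d)) (ℚ.∣p*q∣≡∣p∣*∣q∣ d (a ℚ.- c)) ⟩
    ℚ.∣ a ∣ ℚ.* ℚ.∣ b ℚ.- d ∣ ℚ.+ ℚ.∣ d ∣ ℚ.* ℚ.∣ a ℚ.- c ∣
      ≤⟨ ℚ.+-mono-≤ (*-mono ℚ.∣ a ∣ B ℚ.∣ b ℚ.- d ∣ δ′ (ℚ.0≤∣p∣ a) δ′≥0 a≤B bd)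
                    (*-mono ℚ.∣ d ∣ C ℚ.∣ a ℚ.- c ∣ δ′ (ℚ.0≤∣p∣ d) δ′≥0 d≤C ac) ⟩
    B ℚ.* δ′ ℚ.+ C ℚ.* δ′
      ≡⟨ ℚ.*-distribʳ-+ δ′ B C ⟨
    (B ℚ.+ C) ℚ.* δ′
      ≡⟨ scaled ⟩
    δ ∎
    where open ℚ.≤-Reasoning

  ⊔ˡ : ∀ {a b c} → a ℕ.⊔ b ℕ.≤ c → a ℕ.≤ c
  ⊔ˡ {a} {b} = ℕ.≤-trans (ℕ.m≤m⊔n a b)

  ⊔ʳ : ∀ {a b c} → a ℕ.⊔ b ℕ.≤ c → b ℕ.≤ c
  ⊔ʳ {a} {b} = ℕ.≤-trans (ℕ.m≤n⊔m a b)

  eventuallyBounded : ∀ x → ∃[ B ] 0ℚ ℚ.< B × ∃[ N ] ∀ n → N ℕ.≤ n → ℚ.∣ seq x n ∣ ℚ.≤ B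
  eventuallyBounded x with cauchy x 1ℚ (ℚ.positive⁻¹ 1ℚ)
  ... | N , h = 1ℚ ℚ.+ ℚ.∣ seq x N ∣ , ℚ.+-mono-<-≤ (ℚ.positive⁻¹ 1ℚ) (ℚ.0≤∣p∣ (seq x N)) , N , λ n N≤n →
    ℚ.≤-trans
      (ℚ.≤-reflexive (cong ℚ.∣_∣
        (ring-cancel (seq x n) (seq x N))))
      (ℚ.≤-trans (ℚ.∣p+q∣≤∣p∣+∣q∣ (seq x n ℚ.- seq x N) (seq x N))
                 (ℚ.+-monoˡ-≤ ℚ.∣ seq x N ∣ (h n N N≤n ℕ.≤-refl)))

infixl 6 _+ℝ_
infixl 7 _*ℝ_ _÷ℝ_[_]

_+ℝ_ : ℝ → ℝ → ℝ
(x +ℝ y) .seq n = seq x n ℚ.+ seq y n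
(x +ℝ y) .cauchy δ δ>0
  with cauchy x (δ ℚ.* ℚ.½) (*-pos δ ℚ.½ δ>0 (ℚ.positive⁻¹ ℚ.½))
     | cauchy y (δ ℚ.* ℚ.½) (*-pos δ ℚ.½ δ>0 (ℚ.positive⁻¹ ℚ.½))
... | M , f | N , g = M ℕ.⊔ N , λ m n m≥ n≥ → begin
  ℚ.∣ (seq x m ℚ.+ seq y m) ℚ.- (seq x n ℚ.+ seq y n) ∣
    ≡⟨ cong ℚ.∣_∣ (ring-sum (seq x m) (seq y m) (seq x n) (seq y n)) ⟩
  ℚ.∣ (seq x m ℚ.- seq x n) ℚ.+ (seq y m ℚ.- seq y n) ∣
    ≤⟨ ℚ.∣p+q∣≤∣p∣+∣q∣ (seq x m ℚ.- seq x n) (seq y m ℚ.- seq y n) ⟩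
  ℚ.∣ seq x m ℚ.- seq x n ∣ ℚ.+ ℚ.∣ seq y m ℚ.- seq y n ∣
    ≤⟨ ℚ.+-mono-≤ (f m n (⊔ˡ m≥) (⊔ˡ n≥)) (g m n (⊔ʳ {M} m≥) (⊔ʳ {M} n≥)) ⟩
  δ ℚ.* ℚ.½ ℚ.+ δ ℚ.* ℚ.½
    ≡⟨ ℚ.*-distribˡ-+ δ ℚ.½ ℚ.½ ⟨
  δ ℚ.* 1ℚ
    ≡⟨ ℚ.*-identityʳ δ ⟩
  δ ∎
  where open ℚ.≤-Reasoning

_*ℝ_ : ℝ → ℝ → ℝ
(x *ℝ y) .seq n = seq x n ℚ.* seq y n
(x *ℝ y) .cauchy δ δ>0 =
  let B , B>0 , K , bx = eventuallyBounded x
      C , C>0 , L , by = eventuallyBounded y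
      δ′ , δ′>0 , scaled = scaleDown (B ℚ.+ C) δ (ℚ.+-mono-< B>0 C>0) δ>0
      M , f = cauchy x δ′ δ′>0
      N , g = cauchy y δ′ δ′>0
  in (K ℕ.⊔ L) ℕ.⊔ (M ℕ.⊔ N) , λ m n m≥ n≥ →
    product-close B C δ δ′ (seq x m) (seq y m) (seq x n) (seq y n) (ℚ.<⇒≤ δ′>0) scaled
      (bx m (⊔ˡ {K} (⊔ˡ m≥)))
      (by n (⊔ʳ {K} (⊔ˡ n≥)))
      (f m n (⊔ˡ {M} (⊔ʳ {K ℕ.⊔ L} m≥)) (⊔ˡ {M} (⊔ʳ {K ℕ.⊔ L} n≥)))
      (g m n (⊔ʳ {M} (⊔ʳ {K ℕ.⊔ L} m≥)) (⊔ʳ {M} (⊔ʳ {K ℕ.⊔ L} n≥)))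

-- A positive real is eventually bounded below by some c > 0; its reciprocal
-- inverts the sequence termwise from that index on.

recip : (x : ℝ) → 0ℝ <ℝ x → ℝ
recip x (c , c>0 , N , c≤) = record { seq = r ; cauchy = r-cauchy }
  where
  open ℚ.≤-Reasoning
  a : ℕ → ℚ
  a n = seq x (N ℕ.+ n)
  c≤a : ∀ n → c ℚ.≤ a n
  c≤a n = ℚ.≤-trans (ℚ.≤-reflexive (sym (ℚ.+-identityˡ c))) (c≤ (N ℕ.+ n) (ℕ.m≤m+n N n))
  a>0 : ∀ n → 0ℚ ℚ.< a n
  a>0 n = ℚ.<-≤-trans c>0 (c≤a n)
  instance
    a-nonZero : ∀ {n} → ℚ.NonZero (a n)
    a-nonZero {n} = ℚ.pos⇒nonZero (a n) {{ℚ.positive (a>0 n)}}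
  r : ℕ → ℚ
  r n = ℚ.1/ a n
  r>0 : ∀ n → 0ℚ ℚ.< r n
  r>0 n = ℚ.positive⁻¹ (r n) {{ℚ.1/pos⇒pos (a n) {{ℚ.positive (a>0 n)}}}}
  ar≡1 : ∀ n → a n ℚ.* r n ≡ 1ℚ
  ar≡1 n = ℚ.*-inverseʳ (a n)
  r-diff : ∀ m n → r m ℚ.- r n ≡ (a n ℚ.- a m) ℚ.* (r m ℚ.* r n)
  r-diff m n = begin-equality
    r m ℚ.- r n
      ≡⟨ cong₂ ℚ._-_ (sym (ℚ.*-identityˡ (r m))) (sym (ℚ.*-identityˡ (r n))) ⟩
    1ℚ ℚ.* r m ℚ.- 1ℚ ℚ.* r n
      ≡⟨ cong₂ (λ s t → s ℚ.* r m ℚ.- t ℚ.* r n) (ar≡1 n) (ar≡1 m) ⟨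
    (a n ℚ.* r n) ℚ.* r m ℚ.- (a m ℚ.* r m) ℚ.* r n
      ≡⟨ ring-recip (a n) (r n) (a m) (r m) ⟩
    (a n ℚ.- a m) ℚ.* (r m ℚ.* r n) ∎
  r-cauchy : ∀ δ → 0ℚ ℚ.< δ → ∃[ M ] ∀ m n → M ℕ.≤ m → M ℕ.≤ n → ℚ.∣ r m ℚ.- r n ∣ ℚ.≤ δ
  r-cauchy δ δ>0 with cauchy x (δ ℚ.* (c ℚ.* c)) (*-pos δ (c ℚ.* c) δ>0 (*-pos c c c>0 c>0))
  ... | M , f = M , λ m n m≥ n≥ →
    let rr>0 = *-pos (r m) (r n) (r>0 m) (r>0 n) in begin
    ℚ.∣ r m ℚ.- r n ∣
      ≡⟨ cong ℚ.∣_∣ (r-diff m n) ⟩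
    ℚ.∣ (a n ℚ.- a m) ℚ.* (r m ℚ.* r n) ∣
      ≡⟨ ℚ.∣p*q∣≡∣p∣*∣q∣ (a n ℚ.- a m) (r m ℚ.* r n) ⟩
    ℚ.∣ a n ℚ.- a m ∣ ℚ.* ℚ.∣ r m ℚ.* r n ∣
      ≡⟨ cong (ℚ.∣ a n ℚ.- a m ∣ ℚ.*_) (ℚ.0≤p⇒∣p∣≡p (ℚ.<⇒≤ rr>0)) ⟩
    ℚ.∣ a n ℚ.- a m ∣ ℚ.* (r m ℚ.* r n)
      ≤⟨ ℚ.*-monoʳ-≤-nonNeg (r m ℚ.* r n) {{ℚ.nonNegative (ℚ.<⇒≤ rr>0)}}
           (f _ _ (ℕ.≤-trans n≥ (ℕ.m≤n+m n N)) (ℕ.≤-trans m≥ (ℕ.m≤n+m m N))) ⟩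
    δ ℚ.* (c ℚ.* c) ℚ.* (r m ℚ.* r n)
      ≤⟨ ℚ.*-monoʳ-≤-nonNeg (r m ℚ.* r n) {{ℚ.nonNegative (ℚ.<⇒≤ rr>0)}}
           (ℚ.*-monoˡ-≤-nonNeg δ {{ℚ.nonNegative (ℚ.<⇒≤ δ>0)}}
             (*-mono c (a m) c (a n) (ℚ.<⇒≤ c>0) (ℚ.<⇒≤ (a>0 n)) (c≤a m) (c≤a n))) ⟩
    δ ℚ.* (a m ℚ.* a n) ℚ.* (r m ℚ.* r n)
      ≡⟨ ring-regroup δ (a m) (a n) (r m) (r n) ⟩
    δ ℚ.* ((a m ℚ.* r m) ℚ.* (a n ℚ.* r n))
      ≡⟨ cong₂ (λ s t → δ ℚ.* (s ℚ.* t)) (ar≡1 m) (ar≡1 n) ⟩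
    δ ℚ.* 1ℚ
      ≡⟨ ℚ.*-identityʳ δ ⟩
    δ ∎

_÷ℝ_[_] : ℝ → (y : ℝ) → 0ℝ <ℝ y → ℝ
x ÷ℝ y [ y>0 ] = x *ℝ recip y y>0

------------------------------------------------------------------------
-- Via ws u v: some path from u to v has all its
-- intermediate vertices in ws.

private
  module _ {n} (R : Rel (Fin n) 0ℓ) where

    Via : List (Fin n) → Rel (Fin n) 0ℓ
    Via []       u v = u ≡ v ⊎ R u v
    Via (w ∷ ws) u v = Via ws u v ⊎ (Via ws u w × Via ws w v)

    via? : Decidable R → ∀ ws → Decidable (Via ws)
    via? R? []       u v = (u Fin.≟ v) ⊎-dec R? u v
    via? R? (w ∷ ws) u v = via? R? ws u v ⊎-dec (via? R? ws u w ×-dec via? R? ws w v)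

    via⇒star : ∀ ws {u v} → Via ws u v → Star R u v
    via⇒star []       (inj₁ refl)    = ε
    via⇒star []       (inj₂ r)       = r ◅ ε
    via⇒star (w ∷ ws) (inj₁ p)       = via⇒star ws p
    via⇒star (w ∷ ws) (inj₂ (p , q)) = via⇒star ws p ◅◅ via⇒star ws q

    via-base : ∀ ws {u v} → Via [] u v → Via ws u v
    via-base []       p = p
    via-base (w ∷ ws) p = inj₁ (via-base ws p)

    via-trans : ∀ ws {u w v} → w ∈ˡ ws → Via ws u w → Via ws w v → Via ws u v
    via-trans (x ∷ ws) (here refl) p q = inj₂ (to p , from q)
      where
      to : ∀ {u} → Via (x ∷ ws) u x → Via ws u x
      to (inj₁ a)       = a
      to (inj₂ (a , _)) = a
      from : ∀ {v} → Via (x ∷ ws) x v → Via ws x v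
      from (inj₁ a)       = a
      from (inj₂ (_ , a)) = a
    via-trans (x ∷ ws) (there i) (inj₁ a)       (inj₁ b)       = inj₁ (via-trans ws i a b)
    via-trans (x ∷ ws) (there i) (inj₁ a)       (inj₂ (b , c)) = inj₂ (via-trans ws i a b , c)
    via-trans (x ∷ ws) (there i) (inj₂ (a , b)) (inj₁ c)       = inj₂ (a , via-trans ws i b c)
    via-trans (x ∷ ws) (there i) (inj₂ (a , _)) (inj₂ (_ , d)) = inj₂ (a , d)

    star⇒via : ∀ {u v} → Star R u v → Via (allFin n) u v
    star⇒via ε        = via-base (allFin n) (inj₁ refl)
    star⇒via (r ◅ rs) = via-trans (allFin n) (∈-allFin _) (via-base (allFin n) (inj₂ r)) (star⇒via rs)

star? : ∀ {n} {R : Rel (Fin n) 0ℓ} → Decidable R → Decidable (Star R)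
star? {n} {R} R? u v = map′ (via⇒star R (allFin n)) (star⇒via R) (via? R R? (allFin n) u v)

------------------------------------------------------------------------

module _ (O : DecTotalOrder 0ℓ 0ℓ 0ℓ) where
  open DecTotalOrder O using (Carrier; _≤_; total) renaming (refl to ≤-refl; trans to ≤-trans)

  IsMinimum : ∀ {n} (P : Pred (Subset n) 0ℓ) → (∀ S → .(P S) → Carrier) → Carrier → Set
  IsMinimum P f m = (∃[ S ] Σ (P S) λ p → m ≡ f S p) × (∀ S (p : P S) → m ≤ f S p)

  minimum : ∀ {n} {P : Pred (Subset n) 0ℓ} → U.Decidable P → (f : ∀ S → .(P S) → Carrier) →
            ∃ P → ∃ (IsMinimum P f)
  minimum {zero}  P? f ([] , p) = f [] p , ([] , p , refl) , λ { [] _ → ≤-refl }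
  minimum {suc n} {P} P? f (S , p)
    with anySubset? (λ T → P? (inside ∷ T)) | anySubset? (λ T → P? (outside ∷ T))
  ... | yes i | yes o
    with minimum (λ T → P? (inside ∷ T)) (λ T → f (inside ∷ T)) i
       | minimum (λ T → P? (outside ∷ T)) (λ T → f (outside ∷ T)) o
  ... | a , (A , pA , a≡) , a≤ | b , (B , pB , b≡) , b≤ with total a b
  ... | inj₁ a≤b = a , (inside ∷ A , pA , a≡) ,
                   λ { (true ∷ T) q → a≤ T q ; (false ∷ T) q → ≤-trans a≤b (b≤ T q) }
  ... | inj₂ b≤a = b , (outside ∷ B , pB , b≡) ,
                   λ { (true ∷ T) q → ≤-trans b≤a (a≤ T q) ; (false ∷ T) q → b≤ T q }
  minimum {suc n} {P} P? f (S , p) | yes i | no ¬o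
    with minimum (λ T → P? (inside ∷ T)) (λ T → f (inside ∷ T)) i
  ... | a , (A , pA , a≡) , a≤ = a , (inside ∷ A , pA , a≡) ,
        λ { (true ∷ T) q → a≤ T q ; (false ∷ T) q → contradiction (T , q) ¬o }
  minimum {suc n} {P} P? f (S , p) | no ¬i | yes o
    with minimum (λ T → P? (outside ∷ T)) (λ T → f (outside ∷ T)) o
  ... | b , (B , pB , b≡) , b≤ = b , (outside ∷ B , pB , b≡) ,
        λ { (true ∷ T) q → contradiction (T , q) ¬i ; (false ∷ T) q → b≤ T q }
  minimum {suc n} {P} P? f (true  ∷ T , p) | no ¬i | no _  = contradiction (T , p) ¬i
  minimum {suc n} {P} P? f (false ∷ T , p) | no _  | no ¬o = contradiction (T , p) ¬o

------------------------------------------------------------------------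

record Graph (n : ℕ) : Set₁ where
  infix 4 _~_ _~?_
  field
    _~_      : Rel (Fin n) 0ℓ
    ~-sym    : Symmetric _~_
    ~-irrefl : Irreflexive _≡_ _~_
    _~?_     : Decidable _~_

module _ {n} (G : Graph n) where
  open Graph G

  Complete : Set
  Complete = ∀ u v → u ≢ v → u ~ v

  -- Walks in G − S.  The empty walk also exists at vertices of S, so
  -- endpoints are required to lie outside S wherever this is used.

  Walk : Subset n → Rel (Fin n) 0ℓ
  Walk S = Star (λ u v → u ~ v × u ∉ S × v ∉ S)

  walk? : ∀ S → Decidable (Walk S)
  walk? S = star? λ u v → (u ~? v) ×-dec (¬? (u ∈? S) ×-dec ¬? (v ∈? S))

  -- G − S is connected.

  ConnectedOutside : Pred (Subset n) 0ℓ
  ConnectedOutside S = ∀ u v → u ∉ S → v ∉ S → Walk S u v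

  Connected : Set
  Connected = ConnectedOutside ⊥

  VertexCut : Pred (Subset n) 0ℓ
  VertexCut S = ¬ ConnectedOutside S

  vertexCut? : U.Decidable VertexCut
  vertexCut? S = ¬? (Fin.all? λ u → Fin.all? λ v →
    ¬? (u ∈? S) →-dec (¬? (v ∈? S) →-dec walk? S u v))

  -- c(G − S): keep one vertex from each class of mutually reachable
  -- vertices outside S.

  components : Subset n → ℕ
  components S = length (deduplicate (walk? S) (filter (λ v → ¬? (v ∈? S)) (allFin n)))

  components-nonZero : ∀ {S} → VertexCut S → ℕ.NonZero (components S)
  components-nonZero {S} cut = go _ refl
    where
    go : ∀ vs → vs ≡ filter (λ v → ¬? (v ∈? S)) (allFin n) →
         ℕ.NonZero (length (deduplicate (walk? S) vs))
    go []      eq = contradiction (λ u v u∉S _ → absurd u u∉S) cut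
      where
      absurd : ∀ u → u ∉ S → ∀ {v} → Walk S u v
      absurd u u∉S with subst (u ∈ˡ_) (sym eq) (∈-filter⁺ (λ v → ¬? (v ∈? S)) (∈-allFin u) u∉S)
      ... | ()
    go (_ ∷ _) _  = _

  cutRatio : ∀ S → .(VertexCut S) → ℚ
  cutRatio S cut = (ℤ.+ ∣ S ∣ ℚ./ components S) {{components-nonZero cut}}

  -- For non-adjacent u ≢ v, deleting every other vertex disconnects G.

  ∃-vertexCut : ¬ Complete → ∃ VertexCut
  ∃-vertexCut ¬complete
    with Fin.any? (λ u → Fin.any? λ v → ¬? (u Fin.≟ v) ×-dec ¬? (u ~? v))
  ... | no none = contradiction complete ¬complete
    where
    complete : Complete
    complete u v u≢v with u ~? v
    ... | yes u~v = u~v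
    ... | no  u≁v = contradiction (u , v , u≢v , u≁v) none
  ... | yes (u , v , u≢v , u≁v) = S , λ conn → noWalk (conn u v u∉S v∉S)
    where
    S = ∁ (⁅ u ⁆ ∪ ⁅ v ⁆)
    u∉S : u ∉ S
    u∉S u∈S = x∈∁p⇒x∉p u∈S (x∈p∪q⁺ (inj₁ (x∈⁅x⁆ u)))
    v∉S : v ∉ S
    v∉S v∈S = x∈∁p⇒x∉p v∈S (x∈p∪q⁺ (inj₂ (x∈⁅x⁆ v)))
    noWalk : ¬ Walk S u v
    noWalk ε = u≢v refl
    noWalk ((u~w , _ , w∉S) ◅ _) with x∈p∪q⁻ ⁅ u ⁆ ⁅ v ⁆ (x∉∁p⇒x∈p w∉S)
    ... | inj₁ w∈ = ~-irrefl (sym (x∈⁅y⁆⇒x≡y u w∈)) u~w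
    ... | inj₂ w∈ = u≁v (subst (u ~_) (x∈⁅y⁆⇒x≡y v w∈) u~w)

  IsToughness : ℚ → Set
  IsToughness = IsMinimum ℚ.≤-decTotalOrder VertexCut cutRatio

  toughness-exists : ¬ Complete → ∃ IsToughness
  toughness-exists = minimum ℚ.≤-decTotalOrder vertexCut? cutRatio ∘ ∃-vertexCut

  toughness : ¬ Complete → ℚ
  toughness ¬complete = proj₁ (toughness-exists ¬complete)

  -- Least number of vertices whose removal leaves a disconnected graph or
  -- at most one vertex; in particular a complete graph on n ≥ 1 vertices
  -- has connectivity n − 1.

  Separating : Pred (Subset n) 0ℓ
  Separating S = VertexCut S ⊎ ∣ ∁ S ∣ ℕ.≤ 1

  separating? : U.Decidable Separating
  separating? S = vertexCut? S ⊎-dec (∣ ∁ S ∣ ℕ.≤? 1)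

  IsConnectivity : ℕ → Set
  IsConnectivity = IsMinimum ℕ.≤-decTotalOrder Separating (λ S _ → ∣ S ∣)

  connectivity-exists : ∃ IsConnectivity
  connectivity-exists = minimum ℕ.≤-decTotalOrder separating? (λ S _ → ∣ S ∣) (⊤ , inj₂ ∣∁⊤∣≤1)
    where
    ∣∁⊤∣≤1 : ∣ ∁ (⊤ {n}) ∣ ℕ.≤ 1
    ∣∁⊤∣≤1 rewrite ∣∁p∣≡n∸∣p∣ (⊤ {n}) | ∣⊤∣≡n n | ℕ.n∸n≡0 n = ℕ.z≤n

  κ : ℕ
  κ = proj₁ connectivity-exists

  -- Edges are pairs of adjacent vertices; (u , v) and (v , u) are the same
  -- edge.  A matching lists each of its edges once, in one orientation, so
  -- its number of edges is its length.

  Edge : Set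
  Edge = Σ (Fin n × Fin n) λ (u , v) → u ~ v

  _IsEndOf_ : Fin n → Edge → Set
  w IsEndOf ((u , v) , _) = w ≡ u ⊎ w ≡ v

  SameEdge : Rel Edge 0ℓ
  SameEdge e f = ∀ w → (w IsEndOf e → w IsEndOf f) × (w IsEndOf f → w IsEndOf e)

  Independent : Rel Edge 0ℓ
  Independent e f = ∀ w → ¬ (w IsEndOf e × w IsEndOf f)

  IsMatching : Pred (List Edge) 0ℓ
  IsMatching = AllPairs Independent

  IsPerfectMatching : Pred (List Edge) 0ℓ
  IsPerfectMatching M = IsMatching M × (∀ v → Any (v IsEndOf_) M)

  _ContainedIn_ : Rel (List Edge) 0ℓ
  M ContainedIn P = All (λ e → Any (SameEdge e) P) M

  Extendable : ℕ → Set
  Extendable k =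
    Connected ×
    ∃ IsPerfectMatching ×
    2 ℕ.* k ℕ.+ 2 ℕ.≤ n ×
    (∀ M → IsMatching M → length M ≡ k → ∃[ P ] IsPerfectMatching P × M ContainedIn P)

{-# OPTIONS --safe #-}

-- Multiplying the bound on κ(G) by ε and using |S| ≥ κ(G), |S| ≥ (1 + ε) c(G − S)
-- gives |S| > 2k − 2 + c(G − S) for every vertex cut S.  Let A be the set of ends of a
-- matching with at most k edges.  Repeatedly move into A a vertex covered by every
-- maximum matching of what remains; each move lowers the matching number by one.
-- When no such vertex is left, Gallai's lemma says that a maximum matching M of
-- G − B, with B the enlarged set, misses at most one vertex of each component, so
-- M misses at most c(G − B) vertices.  With the inequality for cuts and parity,
-- the original G − A has a perfect matching.

module Submission where

open import Defs
open import Data.Nat as ℕ using (ℕ; zero; suc; _*_; _∸_; NonZero)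
import Data.Nat.Properties as ℕ
open import Data.Nat.Tactic.RingSolver using (solve-∀)
open import Data.Nat.Divisibility using (_∣_; divides)
import Data.Integer as ℤ
import Data.Integer.Properties as ℤ
open import Data.Rational as ℚ using (ℚ; 0ℚ; 1ℚ)
import Data.Rational.Properties as ℚ
open import Data.Rational.Solver using (module +-*-Solver)
import Data.Rational.Unnormalised as ℚᵘ
import Data.Rational.Unnormalised.Properties as ℚᵘ
open import Data.Fin as Fin using (Fin)
import Data.Fin.Properties as Fin
open import Data.Fin.Subset as Subset using (Subset; inside; outside; ∣_∣; ⁅_⁆; _∪_; ⋃)
import Data.Fin.Subset.Properties as Subset
open import Data.List.Base using (List; []; _∷_; _++_; length; map; filter; allFin)
open import Data.List.Properties using (length-++; length-removeAt′; length-tabulate)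
open import Data.List.Membership.Propositional using (_∈_; _∉_; find)
open import Data.List.Membership.Propositional.Properties using (∈-allFin; ∈-filter⁺; ∈-filter⁻; ∈-++⁺ˡ; ∈-++⁺ʳ)
open import Data.List.Relation.Binary.Permutation.Propositional using (_↭_; prep; swap; ↭-refl; ↭-sym; ↭-trans; ↭⇒↭ₛ)
open import Data.List.Relation.Binary.Permutation.Propositional.Properties using (∈-resp-↭; shifts)
import Data.List.Relation.Binary.Permutation.Setoid.Properties as PermutationSetoid
open import Data.List.Relation.Binary.Subset.Propositional using (_⊆_)
open import Data.List.Relation.Unary.All as All using (All; []; _∷_)
open import Data.List.Relation.Unary.Any as Any using (Any; here; there)
open import Data.List.Relation.Unary.Any.Properties using (deduplicate⁺)
open import Data.List.Relation.Unary.AllPairs using (AllPairs; []; _∷_)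
open import Data.List.Relation.Unary.Unique.Propositional using (Unique)
import Data.List.Relation.Unary.Unique.Propositional.Properties as Unique
open import Data.Product using (Σ; ∃; ∃-syntax; _×_; _,_; proj₁; proj₂)
open import Data.Sum using (_⊎_; inj₁; inj₂)
open import Data.Vec.Base using ([]; _∷_)
open import Function using (_∘_; case_of_)
open import Level using (Level)
open import Relation.Binary.Core using (REL; Rel)
open import Relation.Binary.PropositionalEquality
open import Relation.Binary.Construct.Closure.ReflexiveTransitive as Star using (_◅_; _◅◅_)
open import Relation.Nullary using (¬_; Dec; yes; no; contradiction; ¬?)
open import Relation.Nullary.Decidable using (map′; _×-dec_; decidable-stable)
open import Relation.Unary using (Pred)

-- Natural numbers as rationals.

⟦_⟧ : ℕ → ℚ
⟦ m ⟧ = ℤ.+ m ℚ./ 1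

-- The comparison passes through unnormalised rationals because the gcd in the normal form does not
-- compute on variables.
⟦⟧-mono-≤ : ∀ {m n} → m ℕ.≤ n → ⟦ m ⟧ ℚ.≤ ⟦ n ⟧
⟦⟧-mono-≤ {m} {n} m≤n = ℚ.toℚᵘ-cancel-≤ (begin
  ℚ.toℚᵘ ⟦ m ⟧            ≃⟨ ℚ.toℚᵘ-fromℚᵘ (ℚᵘ.mkℚᵘ (ℤ.+ m) 0) ⟩
  ℚᵘ.mkℚᵘ (ℤ.+ m) 0       ≤⟨ ℚᵘ.*≤* (ℤ.*-monoʳ-≤-nonNeg (ℤ.+ 1) (ℤ.+≤+ m≤n)) ⟩
  ℚᵘ.mkℚᵘ (ℤ.+ n) 0       ≃⟨ ℚ.toℚᵘ-fromℚᵘ (ℚᵘ.mkℚᵘ (ℤ.+ n) 0) ⟨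
  ℚ.toℚᵘ ⟦ n ⟧            ∎)
  where open ℚᵘ.≤-Reasoning

⟦⟧-homo-+ : ∀ m n → ⟦ m ℕ.+ n ⟧ ≡ ⟦ m ⟧ ℚ.+ ⟦ n ⟧
⟦⟧-homo-+ m n = ℚ.toℚᵘ-injective (begin-equality
  ℚ.toℚᵘ ⟦ m ℕ.+ n ⟧
    ≃⟨ ℚ.toℚᵘ-fromℚᵘ (ℚᵘ.mkℚᵘ (ℤ.+ (m ℕ.+ n)) 0) ⟩
  ℚᵘ.mkℚᵘ (ℤ.+ (m ℕ.+ n)) 0
    ≃⟨ ℚᵘ.*≡* (cong (ℤ._* ℤ.+ 1) (trans (ℤ.pos-+ m n)
         (sym (cong₂ ℤ._+_ (ℤ.*-identityʳ (ℤ.+ m)) (ℤ.*-identityʳ (ℤ.+ n)))))) ⟩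
  ℚᵘ.mkℚᵘ (ℤ.+ m) 0 ℚᵘ.+ ℚᵘ.mkℚᵘ (ℤ.+ n) 0
    ≃⟨ ℚᵘ.+-cong (ℚ.toℚᵘ-fromℚᵘ (ℚᵘ.mkℚᵘ (ℤ.+ m) 0)) (ℚ.toℚᵘ-fromℚᵘ (ℚᵘ.mkℚᵘ (ℤ.+ n) 0)) ⟨
  ℚ.toℚᵘ ⟦ m ⟧ ℚᵘ.+ ℚ.toℚᵘ ⟦ n ⟧
    ≃⟨ ℚ.toℚᵘ-homo-+ ⟦ m ⟧ ⟦ n ⟧ ⟨
  ℚ.toℚᵘ (⟦ m ⟧ ℚ.+ ⟦ n ⟧) ∎)
  where open ℚᵘ.≤-Reasoning

-- Clears the denominator of `cutRatio`.
⟦⟧*/ : ∀ s q .{{_ : NonZero q}} → ⟦ q ⟧ ℚ.* (ℤ.+ s ℚ./ q) ≡ ⟦ s ⟧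
⟦⟧*/ s (suc q-1) = ℚ.toℚᵘ-injective (begin-equality
  ℚ.toℚᵘ (⟦ q ⟧ ℚ.* (ℤ.+ s ℚ./ q))
    ≃⟨ ℚ.toℚᵘ-homo-* ⟦ q ⟧ (ℤ.+ s ℚ./ q) ⟩
  ℚ.toℚᵘ ⟦ q ⟧ ℚᵘ.* ℚ.toℚᵘ (ℤ.+ s ℚ./ q)
    ≃⟨ ℚᵘ.*-cong (ℚ.toℚᵘ-fromℚᵘ (ℚᵘ.mkℚᵘ (ℤ.+ q) 0)) (ℚ.toℚᵘ-fromℚᵘ (ℚᵘ.mkℚᵘ (ℤ.+ s) q-1)) ⟩
  ℚᵘ.mkℚᵘ (ℤ.+ q) 0 ℚᵘ.* ℚᵘ.mkℚᵘ (ℤ.+ s) q-1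
    ≃⟨ ℚᵘ.*≡* (trans (ℤ.*-identityʳ _) (trans (ℤ.*-comm (ℤ.+ q) (ℤ.+ s))
         (cong (ℤ.+ s ℤ.*_) (sym (ℤ.*-identityˡ (ℤ.+ q)))))) ⟩
  ℚᵘ.mkℚᵘ (ℤ.+ s) 0
    ≃⟨ ℚ.toℚᵘ-fromℚᵘ (ℚᵘ.mkℚᵘ (ℤ.+ s) 0) ⟨
  ℚ.toℚᵘ ⟦ s ⟧ ∎)
  where
  open ℚᵘ.≤-Reasoning
  q = suc q-1

-- From the real hypotheses to an integer inequality for vertex cuts.

module _ where
  open +-*-Solver
  open ℚ.≤-Reasoning

  -- Here e and a are two terms of the sequence of ε, as the reciprocal in ÷ℝ shifts its index,
  -- and x is their distance; s ≤ K + q is refuted by taking x small.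
  cut-estimate : ∀ {K s q l e a r d t x} →
    0ℚ ℚ.≤ q → 0ℚ ℚ.≤ s → 0ℚ ℚ.≤ a → 0ℚ ℚ.≤ 1ℚ ℚ.+ e → a ℚ.* r ≡ 1ℚ →
    K ℚ.* (1ℚ ℚ.+ e) ℚ.* r ℚ.+ d ℚ.≤ l → l ℚ.≤ s →
    1ℚ ℚ.+ e ℚ.≤ t ℚ.+ x → q ℚ.* t ℚ.≤ s → a ℚ.≤ e ℚ.+ x → s ℚ.≤ K ℚ.+ q →
    d ℚ.* a ℚ.≤ (s ℚ.+ q) ℚ.* x
  cut-estimate {K} {s} {q} {l} {e} {a} {r} {d} {t} {x} q≥0 s≥0 a≥0 e≥-1 ar≡1 κ-bound l≤s t-bound qt≤s a≤ s≤K+q = begin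
    d ℚ.* a
      ≡⟨ solve 2 (λ p y → p := (p :+ y) :+ :- y) refl (d ℚ.* a) ((K ℚ.+ q) ℚ.* (1ℚ ℚ.+ e)) ⟩
    (d ℚ.* a ℚ.+ (K ℚ.+ q) ℚ.* f) ℚ.- (K ℚ.+ q) ℚ.* f
      ≤⟨ ℚ.+-monoˡ-≤ (ℚ.- ((K ℚ.+ q) ℚ.* f)) sum ⟩
    ((K ℚ.+ q) ℚ.* f ℚ.+ (s ℚ.+ q) ℚ.* x) ℚ.- (K ℚ.+ q) ℚ.* f
      ≡⟨ solve 2 (λ p y → (y :+ p) :+ :- y := p) refl ((s ℚ.+ q) ℚ.* x) ((K ℚ.+ q) ℚ.* f) ⟩
    (s ℚ.+ q) ℚ.* x ∎
    where
    f = 1ℚ ℚ.+ e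
    κ-part : K ℚ.* f ℚ.+ d ℚ.* a ℚ.≤ s ℚ.* (e ℚ.+ x)
    κ-part = begin
      K ℚ.* f ℚ.+ d ℚ.* a
        ≡⟨ cong (ℚ._+ d ℚ.* a) (ℚ.*-identityʳ (K ℚ.* f)) ⟨
      K ℚ.* f ℚ.* 1ℚ ℚ.+ d ℚ.* a
        ≡⟨ cong (λ y → K ℚ.* f ℚ.* y ℚ.+ d ℚ.* a) ar≡1 ⟨
      K ℚ.* f ℚ.* (a ℚ.* r) ℚ.+ d ℚ.* a
        ≡⟨ solve 4 (λ p a r d → p :* (a :* r) :+ d :* a := (p :* r :+ d) :* a) refl (K ℚ.* f) a r d ⟩
      (K ℚ.* f ℚ.* r ℚ.+ d) ℚ.* a
        ≤⟨ ℚ.*-monoʳ-≤-nonNeg a {{ℚ.nonNegative a≥0}} (ℚ.≤-trans κ-bound l≤s) ⟩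
      s ℚ.* a
        ≤⟨ ℚ.*-monoˡ-≤-nonNeg s {{ℚ.nonNegative s≥0}} a≤ ⟩
      s ℚ.* (e ℚ.+ x) ∎
    t-part : q ℚ.* f ℚ.≤ s ℚ.+ q ℚ.* x
    t-part = begin
      q ℚ.* f                  ≤⟨ ℚ.*-monoˡ-≤-nonNeg q {{ℚ.nonNegative q≥0}} t-bound ⟩
      q ℚ.* (t ℚ.+ x)          ≡⟨ ℚ.*-distribˡ-+ q t x ⟩
      q ℚ.* t ℚ.+ q ℚ.* x      ≤⟨ ℚ.+-monoˡ-≤ (q ℚ.* x) qt≤s ⟩
      s ℚ.+ q ℚ.* x            ∎
    -- The terms `s * e` and `s` merge into `s * f`. The assumption `s ≤ K + q` then gives both
    -- sides the same main term, which the chain above cancels.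
    sum : d ℚ.* a ℚ.+ (K ℚ.+ q) ℚ.* f ℚ.≤ (K ℚ.+ q) ℚ.* f ℚ.+ (s ℚ.+ q) ℚ.* x
    sum = begin
      d ℚ.* a ℚ.+ (K ℚ.+ q) ℚ.* f
        ≡⟨ solve 4 (λ p K q f → p :+ (K :+ q) :* f := (K :* f :+ p) :+ q :* f) refl (d ℚ.* a) K q f ⟩
      (K ℚ.* f ℚ.+ d ℚ.* a) ℚ.+ q ℚ.* f
        ≤⟨ ℚ.+-mono-≤ κ-part t-part ⟩
      s ℚ.* (e ℚ.+ x) ℚ.+ (s ℚ.+ q ℚ.* x)
        ≡⟨ solve 4 (λ s e x q → s :* (e :+ x) :+ (s :+ q :* x) := s :* (con 1ℚ :+ e) :+ (s :+ q) :* x) refl s e x q ⟩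
      s ℚ.* f ℚ.+ (s ℚ.+ q) ℚ.* x
        ≤⟨ ℚ.+-monoˡ-≤ ((s ℚ.+ q) ℚ.* x) (ℚ.*-monoʳ-≤-nonNeg f {{ℚ.nonNegative e≥-1}} s≤K+q) ⟩
      (K ℚ.+ q) ℚ.* f ℚ.+ (s ℚ.+ q) ℚ.* x ∎

p≤∣p∣ : ∀ p → p ℚ.≤ ℚ.∣ p ∣
p≤∣p∣ p with ℚ.≤-total 0ℚ p
... | inj₁ p≥0 = ℚ.≤-reflexive (sym (ℚ.0≤p⇒∣p∣≡p p≥0))
... | inj₂ p≤0 = ℚ.≤-trans p≤0 (ℚ.0≤∣p∣ p)

∣p-q∣≤r⇒p≤q+r : ∀ {p q r} → ℚ.∣ p ℚ.- q ∣ ℚ.≤ r → p ℚ.≤ q ℚ.+ r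
∣p-q∣≤r⇒p≤q+r {p} {q} {r} ∣p-q∣≤r = begin
  p                    ≡⟨ solve 2 (λ p q → p := q :+ (p :- q)) refl p q ⟩
  q ℚ.+ (p ℚ.- q)      ≤⟨ ℚ.+-monoʳ-≤ q (ℚ.≤-trans (p≤∣p∣ (p ℚ.- q)) ∣p-q∣≤r) ⟩
  q ℚ.+ r              ∎
  where
  open +-*-Solver
  open ℚ.≤-Reasoning

positive-* : ∀ {p q} → 0ℚ ℚ.< p → 0ℚ ℚ.< q → 0ℚ ℚ.< p ℚ.* q
positive-* {p} {q} p>0 q>0 =
  ℚ.positive⁻¹ (p ℚ.* q) {{ℚ.pos*pos⇒pos p {{ℚ.positive p>0}} q {{ℚ.positive q>0}}}}

small-multiplier : ∀ m {p} → 0ℚ ℚ.< p → ∃[ x ] 0ℚ ℚ.< x × ⟦ m ⟧ ℚ.* x ℚ.< p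
small-multiplier m {p} p>0 = x , x>0 , (begin-strict
  ⟦ m ⟧ ℚ.* x                  ≡⟨ ℚ.+-identityˡ (⟦ m ⟧ ℚ.* x) ⟨
  0ℚ ℚ.+ ⟦ m ⟧ ℚ.* x           <⟨ ℚ.+-monoˡ-< (⟦ m ⟧ ℚ.* x) x>0 ⟩
  x ℚ.+ ⟦ m ⟧ ℚ.* x            ≡⟨ cong (ℚ._+ ⟦ m ⟧ ℚ.* x) (ℚ.*-identityˡ x) ⟨
  1ℚ ℚ.* x ℚ.+ ⟦ m ⟧ ℚ.* x     ≡⟨ ℚ.*-distribʳ-+ x 1ℚ ⟦ m ⟧ ⟨
  (1ℚ ℚ.+ ⟦ m ⟧) ℚ.* x         ≡⟨ cong (ℚ._* x) (⟦⟧-homo-+ 1 m) ⟨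
  σ ℚ.* (ℚ.1/ σ ℚ.* p)         ≡⟨ ℚ.*-assoc σ (ℚ.1/ σ) p ⟨
  (σ ℚ.* ℚ.1/ σ) ℚ.* p         ≡⟨ cong (ℚ._* p) (ℚ.*-inverseʳ σ) ⟩
  1ℚ ℚ.* p                     ≡⟨ ℚ.*-identityˡ p ⟩
  p                            ∎)
  where
  open ℚ.≤-Reasoning
  σ = ⟦ suc m ⟧
  instance
    σ-positive : ℚ.Positive σ
    σ-positive = ℚ.positive (ℚ.<-≤-trans (ℚ.positive⁻¹ 1ℚ) (⟦⟧-mono-≤ {1} {suc m} (ℕ.s≤s ℕ.z≤n)))
    σ-nonZero : ℚ.NonZero σ
    σ-nonZero = ℚ.pos⇒nonZero σ
  -- Dividing by `m + 1` instead of `m` makes the inequality strict and covers `m = 0`.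
  x = ℚ.1/ σ ℚ.* p
  x>0 : 0ℚ ℚ.< x
  x>0 = positive-* (ℚ.positive⁻¹ (ℚ.1/ σ) {{ℚ.1/pos⇒pos σ}}) p>0

-- If the bound failed, the estimate would give `d * c ≤ (s + q) * x` for every positive `x`, where
-- `d` is the gap in the hypothesis on `κ G` and `c` an eventual lower bound of `ε`. A small enough
-- `x` violates this.
cut-bound : ∀ K (ε : ℝ) (ε>0 : 0ℝ <ℝ ε) {n} (G : Graph n) (nc : ¬ Complete G) →
  1ℝ +ℝ ε ≤ℝ fromℚ (toughness G nc) →
  (fromℕ K *ℝ (1ℝ +ℝ ε)) ÷ℝ ε [ ε>0 ] <ℝ fromℕ (κ G) →
  ∀ S → VertexCut G S → suc (K ℕ.+ components G S) ℕ.≤ ∣ S ∣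
cut-bound K ε (c , c>0 , M , c≤) G nc tough (d , d>0 , N , conn) S cut = ℕ.≰⇒> λ s≤K+q →
  let x , x>0 , small = small-multiplier (s ℕ.+ q) (positive-* d>0 c>0)
      L , close = ℝ.cauchy ε x x>0
      T , t-bound = tough x x>0
      -- This index lies past all four thresholds: `M` for the lower bound on `ε`, `N` for the
      -- connectivity, `L` for the Cauchy condition at `x`, `T` for the toughness. The reciprocal of
      -- `ε` at index `i` inverts the term at `M + i`, hence the two terms `e` and `a`.
      i = M ℕ.+ (N ℕ.+ (L ℕ.+ T))
      N≤ = ℕ.≤-trans (ℕ.m≤m+n N (L ℕ.+ T)) (ℕ.m≤n+m _ M)
      L≤ = ℕ.≤-trans (ℕ.≤-trans (ℕ.m≤m+n L T) (ℕ.m≤n+m _ N)) (ℕ.m≤n+m _ M)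
      T≤ = ℕ.≤-trans (ℕ.≤-trans (ℕ.m≤n+m T L) (ℕ.m≤n+m _ N)) (ℕ.m≤n+m _ M)
      e = seq ε i
      a = seq ε (M ℕ.+ i)
      c≤a = c≤′ (M ℕ.+ i) (ℕ.m≤m+n M i)
      a>0 = ℚ.<-≤-trans c>0 c≤a
      instance
        a-nonZero : ℚ.NonZero a
        a-nonZero = ℚ.pos⇒nonZero a {{ℚ.positive a>0}}
  in ℚ.<-irrefl refl (begin-strict
    d ℚ.* c
      ≤⟨ ℚ.*-monoˡ-≤-nonNeg d {{ℚ.nonNegative (ℚ.<⇒≤ d>0)}} c≤a ⟩
    d ℚ.* a
      ≤⟨ cut-estimate {⟦ K ⟧} {⟦ s ⟧} {⟦ q ⟧} {⟦ κ G ⟧} {e} {a} {ℚ.1/ a} {d} {toughness G nc} {x}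
           (⟦⟧-mono-≤ {0} {q} ℕ.z≤n) (⟦⟧-mono-≤ {0} {s} ℕ.z≤n) (ℚ.<⇒≤ a>0)
           (ℚ.+-mono-≤ (ℚ.<⇒≤ (ℚ.positive⁻¹ 1ℚ)) (ℚ.≤-trans (ℚ.<⇒≤ c>0) (c≤′ i (ℕ.m≤m+n M _))))
           (ℚ.*-inverseʳ a) (conn i N≤) (⟦⟧-mono-≤ κ≤s) (t-bound i T≤) qt≤s
           (∣p-q∣≤r⇒p≤q+r {a} {e} {x} (close (M ℕ.+ i) i (ℕ.≤-trans L≤ (ℕ.m≤n+m i M)) L≤))
           (ℚ.≤-trans (⟦⟧-mono-≤ s≤K+q) (ℚ.≤-reflexive (⟦⟧-homo-+ K q))) ⟩
    (⟦ s ⟧ ℚ.+ ⟦ q ⟧) ℚ.* x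
      ≡⟨ cong (ℚ._* x) (⟦⟧-homo-+ s q) ⟨
    ⟦ s ℕ.+ q ⟧ ℚ.* x
      <⟨ small ⟩
    d ℚ.* c ∎)
  where
  open ℚ.≤-Reasoning
  s = ∣ S ∣
  q = components G S
  c≤′ : ∀ j → M ℕ.≤ j → c ℚ.≤ seq ε j
  c≤′ j M≤j = ℚ.≤-trans (ℚ.≤-reflexive (sym (ℚ.+-identityˡ c))) (c≤ j M≤j)
  κ≤s : κ G ℕ.≤ s
  κ≤s = proj₂ (proj₂ (connectivity-exists G)) S (inj₁ cut)
  qt≤s : ⟦ q ⟧ ℚ.* toughness G nc ℚ.≤ ⟦ s ⟧
  qt≤s = ℚ.≤-trans
    (ℚ.*-monoˡ-≤-nonNeg ⟦ q ⟧ {{ℚ.nonNegative (⟦⟧-mono-≤ {0} {q} ℕ.z≤n)}}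
      (proj₂ (proj₂ (toughness-exists G nc)) S cut))
    (ℚ.≤-reflexive (⟦⟧*/ s q {{components-nonZero G cut}}))

-- Counting with lists and finite subsets.

module _ {a b ℓ : Level} {A : Set a} {B : Set b} where

  ─⁺ : {P Q : Pred B ℓ} → (∀ {y} → P y → ¬ Q y) → ∀ {ys} (p : Any P ys) →
    Any Q ys → Any Q (ys Any.─ p)
  ─⁺ P⇒¬Q (here py) (here qy) = contradiction qy (P⇒¬Q py)
  ─⁺ P⇒¬Q (here _)  (there q) = q
  ─⁺ P⇒¬Q (there _) (here qy) = here qy
  ─⁺ P⇒¬Q (there p) (there q) = there (─⁺ P⇒¬Q p q)

  -- Pigeonhole principle: each `x` uses up one element of `ys`, and disjointness keeps the images
  -- of later elements intact when it is deleted. A general relation serves both for inclusion of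
  -- lists, with equality, and for counting components, with walks.
  length-≤-of-disjoint-images : {R : REL A B ℓ} → ∀ {xs ys} →
    AllPairs (λ x x′ → ∀ y → R x y → ¬ R x′ y) xs → (∀ {x} → x ∈ xs → Any (R x) ys) →
    length xs ℕ.≤ length ys
  length-≤-of-disjoint-images []           image = ℕ.z≤n
  length-≤-of-disjoint-images {R} {ys = ys} (dx ∷ dxs) image =
    ℕ.≤-trans
      (ℕ.s≤s (length-≤-of-disjoint-images dxs λ x′∈ →
        ─⁺ (All.lookup dx x′∈ _) p (image (there x′∈))))
      (ℕ.≤-reflexive (sym (length-removeAt′ ys (Any.index p))))
    where p = image (here refl)

module _ {a : Level} {A : Set a} where

  unique-⊆⇒length-≤ : {xs ys : List A} → Unique xs → xs ⊆ ys → length xs ℕ.≤ length ys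
  unique-⊆⇒length-≤ xs! = length-≤-of-disjoint-images (distinct xs!)
    where
    distinct : ∀ {xs : List A} → Unique xs → AllPairs (λ x x′ → ∀ y → x ≡ y → x′ ≢ y) xs
    distinct []         = []
    distinct (x∉ ∷ xs!) = All.map (λ x≢x′ _ x≡y x′≡y → x≢x′ (trans x≡y (sym x′≡y))) x∉ ∷ distinct xs!

  unique⇒allPairs : ∀ {ℓ} {R : Rel A ℓ} {xs} → Unique xs →
    (∀ {x y} → x ∈ xs → y ∈ xs → x ≢ y → R x y) → AllPairs R xs
  unique⇒allPairs []         r = []
  unique⇒allPairs (x∉ ∷ xs!) r =
    All.tabulate (λ y∈ → r (here refl) (there y∈) (All.lookup x∉ y∈)) ∷
    unique⇒allPairs xs! λ x∈ y∈ → r (there x∈) (there y∈)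

  unique-∷ : ∀ {x : A} {xs} → x ∉ xs → Unique xs → Unique (x ∷ xs)
  unique-∷ x∉xs xs! = All.tabulate (λ y∈xs x≡y → x∉xs (subst (_∈ _) (sym x≡y) y∈xs)) ∷ xs!

  Unique-resp-↭ : {xs ys : List A} → xs ↭ ys → Unique xs → Unique ys
  Unique-resp-↭ p = PermutationSetoid.Unique-resp-↭ (setoid A) (↭⇒↭ₛ p)

module _ {n : ℕ} where

  open import Data.List.Membership.DecPropositional (Fin._≟_ {n}) public using (_∈?_)

  unique⇒length-≤ : {xs : List (Fin n)} → Unique xs → length xs ℕ.≤ n
  unique⇒length-≤ {xs} xs! = subst (length xs ℕ.≤_) (length-tabulate {n = n} λ i → i)
    (unique-⊆⇒length-≤ xs! λ {x} _ → ∈-allFin x)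

  unique-length⇒∈ : {xs : List (Fin n)} → Unique xs → length xs ≡ n → ∀ x → x ∈ xs
  unique-length⇒∈ {xs} xs! len x = decidable-stable (x ∈? xs) λ x∉xs →
    ℕ.<-irrefl len (unique⇒length-≤ (unique-∷ x∉xs xs!))

  toSubset : List (Fin n) → Subset n
  toSubset = ⋃ ∘ map ⁅_⁆

  ∈⇒∈-toSubset : ∀ {x xs} → x ∈ xs → x Subset.∈ toSubset xs
  ∈⇒∈-toSubset {x} (here refl) = Subset.x∈p∪q⁺ (inj₁ (Subset.x∈⁅x⁆ x))
  ∈⇒∈-toSubset (there x∈xs)    = Subset.x∈p∪q⁺ (inj₂ (∈⇒∈-toSubset x∈xs))

  ∈-toSubset⇒∈ : ∀ {x} xs → x Subset.∈ toSubset xs → x ∈ xs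
  ∈-toSubset⇒∈ []       x∈ = contradiction x∈ Subset.∉⊥
  ∈-toSubset⇒∈ (y ∷ xs) x∈ with Subset.x∈p∪q⁻ ⁅ y ⁆ (toSubset xs) x∈
  ... | inj₁ x∈y  = here (Subset.x∈⁅y⁆⇒x≡y y x∈y)
  ... | inj₂ x∈xs = there (∈-toSubset⇒∈ xs x∈xs)

∣p∪q∣≤∣p∣+∣q∣ : ∀ {n} (p q : Subset n) → ∣ p ∪ q ∣ ℕ.≤ ∣ p ∣ ℕ.+ ∣ q ∣
∣p∪q∣≤∣p∣+∣q∣ []            []            = ℕ.z≤n
∣p∪q∣≤∣p∣+∣q∣ (outside ∷ p) (outside ∷ q) = ∣p∪q∣≤∣p∣+∣q∣ p q
∣p∪q∣≤∣p∣+∣q∣ (outside ∷ p) (inside  ∷ q) =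
  ℕ.≤-trans (ℕ.s≤s (∣p∪q∣≤∣p∣+∣q∣ p q)) (ℕ.≤-reflexive (sym (ℕ.+-suc ∣ p ∣ ∣ q ∣)))
∣p∪q∣≤∣p∣+∣q∣ (inside  ∷ p) (outside ∷ q) = ℕ.s≤s (∣p∪q∣≤∣p∣+∣q∣ p q)
∣p∪q∣≤∣p∣+∣q∣ (inside  ∷ p) (inside  ∷ q) =
  ℕ.s≤s (ℕ.≤-trans (∣p∪q∣≤∣p∣+∣q∣ p q) (ℕ.+-monoʳ-≤ ∣ p ∣ (ℕ.n≤1+n ∣ q ∣)))

∣toSubset∣≤length : ∀ {n} (xs : List (Fin n)) → ∣ toSubset xs ∣ ℕ.≤ length xs
∣toSubset∣≤length {n} []       = ℕ.≤-reflexive (Subset.∣⊥∣≡0 n)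
∣toSubset∣≤length     (x ∷ xs) = ℕ.≤-trans (∣p∪q∣≤∣p∣+∣q∣ ⁅ x ⁆ (toSubset xs))
  (ℕ.+-mono-≤ (ℕ.≤-reflexive (Subset.∣⁅x⁆∣≡1 x)) (∣toSubset∣≤length xs))

-- Walks and components.

module _ {n} (G : Graph n) where
  open Graph G

  walk-sym : ∀ S {u v} → Walk G S u v → Walk G S v u
  walk-sym S = Star.reverse λ (u~v , u∉S , v∉S) → ~-sym u~v , v∉S , u∉S

  -- Each `u` has a walk to the representative kept from its class, and a shared representative
  -- would join two of the vertices.
  length-≤-components : ∀ S {us} → (∀ {u} → u ∈ us → u Subset.∉ S) →
    AllPairs (λ u v → ¬ Walk G S u v) us → length us ℕ.≤ components G S
  length-≤-components S {us} us∉S apart = length-≤-of-disjoint-images (disjoint apart) λ {u} u∈us →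
    deduplicate⁺ (walk? G S) (λ walk-yx walk-xu → walk-yx ◅◅ walk-xu)
      (Any.map (λ { refl → Star.ε }) (∈-filter⁺ (λ v → ¬? (v Subset.∈? S)) (∈-allFin u) (us∉S u∈us)))
    where
    disjoint : ∀ {us} → AllPairs (λ u v → ¬ Walk G S u v) us →
      AllPairs (λ u v → ∀ w → Walk G S w u → ¬ Walk G S w v) us
    disjoint []           = []
    disjoint (u∉ ∷ apart) = All.map (λ ¬uv _ wu wv → ¬uv (walk-sym S wu ◅◅ wv)) u∉ ∷ disjoint apart

  -- Matchings that avoid a list of vertices.

  ends : List (Edge G) → List (Fin n)
  ends []                  = []
  ends (((u , v) , _) ∷ M) = u ∷ v ∷ ends M

  length-ends : ∀ M → length (ends M) ≡ 2 * length M
  length-ends []      = refl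
  length-ends (_ ∷ M) = trans (cong (suc ∘ suc) (length-ends M)) (sym (ℕ.*-suc 2 (length M)))

  -- A permutation is needed since the edge at `x` may stand anywhere in the list and in either
  -- orientation.
  extract : ∀ M {x} → x ∈ ends M →
    ∃[ y ] ∃[ M′ ] x ~ y × length M ≡ suc (length M′) × ends M ↭ x ∷ y ∷ ends M′
  extract (((u , v) , u~v) ∷ M) (here refl)         = v , M , u~v , refl , ↭-refl
  extract (((u , v) , u~v) ∷ M) (there (here refl)) = u , M , ~-sym u~v , refl , swap u v ↭-refl
  extract (e@((u , v) , _) ∷ M) (there (there x∈M)) with extract M x∈M
  ... | y , M′ , x~y , len , p = y , e ∷ M′ , x~y , cong suc len ,
    ↭-trans (prep u (prep v p)) (shifts (u ∷ v ∷ []) (_ ∷ y ∷ []))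

  -- Independence is encoded as uniqueness of the list of all ends, which turns counting and
  -- deletion into list operations. Keeping `A` as a list makes the deletion of a further vertex a
  -- cons.
  record MatchingAvoiding (A : List (Fin n)) (m : ℕ) : Set where
    field
      edges  : List (Edge G)
      size   : length edges ≡ m
      unique : Unique (ends edges)
      avoids : ∀ {w} → w ∈ ends edges → w ∉ A

    covered : List (Fin n)
    covered = ends edges

    length-covered : length covered ≡ 2 * m
    length-covered = trans (length-ends edges) (cong (2 *_) size)

  open MatchingAvoiding

  ∅ : ∀ {A} → MatchingAvoiding A 0
  ∅ = record { edges = [] ; size = refl ; unique = [] ; avoids = λ () }

  weaken : ∀ {A B m} → A ⊆ B → MatchingAvoiding B m → MatchingAvoiding A m
  weaken A⊆B M = record { MatchingAvoiding M ; avoids = λ w∈M → avoids M w∈M ∘ A⊆B }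

  avoid : ∀ {A m x} (M : MatchingAvoiding A m) → x ∉ covered M → MatchingAvoiding (x ∷ A) m
  avoid M x∉M = record { MatchingAvoiding M ; avoids = λ where
    w∈M (here refl)  → x∉M w∈M
    w∈M (there w∈A) → avoids M w∈M w∈A }

  insert : ∀ {A m u v} → u ~ v → u ∉ A → v ∉ A →
    MatchingAvoiding (u ∷ v ∷ A) m → MatchingAvoiding A (suc m)
  insert {u = u} {v} u~v u∉A v∉A M = record
    { edges  = ((u , v) , u~v) ∷ edges M
    ; size   = cong suc (size M)
    ; unique = unique-∷ (λ { (here u≡v) → ~-irrefl u≡v u~v ; (there u∈M) → avoids M u∈M (here refl) })
                 (unique-∷ (λ v∈M → avoids M v∈M (there (here refl))) (unique M))
    ; avoids = λ { (here refl) → u∉A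
                 ; (there (here refl)) → v∉A
                 ; (there (there w∈M)) → avoids M w∈M ∘ there ∘ there }
    }

  remove : ∀ {A m x} (M : MatchingAvoiding A (suc m)) → x ∈ covered M →
    ∃[ y ] x ~ y × Σ (MatchingAvoiding (x ∷ y ∷ A) m) λ M′ → covered M ↭ x ∷ y ∷ covered M′
  remove {x = x} M x∈M with extract (edges M) x∈M
  ... | y , M′ , x~y , len , p with Unique-resp-↭ p (unique M)
  ... | (_ ∷ x∉) ∷ y∉ ∷ M′! = y , x~y , record
    { edges  = M′
    ; size   = ℕ.suc-injective (trans (sym len) (size M))
    ; unique = M′!
    ; avoids = λ { w∈M′ (here refl) → All.lookup x∉ w∈M′ refl
                 ; w∈M′ (there (here refl)) → All.lookup y∉ w∈M′ refl
                 ; w∈M′ (there (there w∈A)) → avoids M (∈-resp-↭ (↭-sym p) (there (there w∈M′))) w∈A }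
    } , p

  -- A nonempty matching of `G - A` amounts to an edge `uv` of `G - A` with a matching of what
  -- remains without `u` and `v`, so a search over edges decides. This makes the later arguments by
  -- contradiction constructive.
  matchingAvoiding? : ∀ m A → Dec (MatchingAvoiding A m)
  matchingAvoiding? zero    A = yes ∅
  matchingAvoiding? (suc m) A = map′
    (λ (u , v , u~v , u∉A , v∉A , M) → insert u~v u∉A v∉A M)
    (λ M → first M (edges M) refl)
    (Fin.any? λ u → Fin.any? λ v → (u ~? v) ×-dec (¬? (u ∈? A) ×-dec (¬? (v ∈? A) ×-dec
      matchingAvoiding? m (u ∷ v ∷ A))))
    where
    first : (M : MatchingAvoiding A (suc m)) → ∀ es → edges M ≡ es →
      ∃[ u ] ∃[ v ] u ~ v × u ∉ A × v ∉ A × MatchingAvoiding (u ∷ v ∷ A) m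
    first M [] eq = case trans (sym (size M)) (cong length eq) of λ ()
    first M (((u , _) , _) ∷ _) eq with remove M (subst (λ es → u ∈ ends es) (sym eq) (here refl))
    ... | v , u~v , M′ , p = u , v , u~v ,
      avoids M (∈-resp-↭ (↭-sym p) (here refl)) ,
      avoids M (∈-resp-↭ (↭-sym p) (there (here refl))) , M′

  -- If x is covered by M but not by N and is matched to y in M, then y is
  -- covered by N, as N is maximum; deleting x, y and the edges at them leaves
  -- a smaller instance, whose solution is completed by the edge xy.
  exchange : ∀ m {A u v t} → u ≢ v → ¬ MatchingAvoiding A (suc m) →
    MatchingAvoiding (u ∷ v ∷ A) m → MatchingAvoiding (t ∷ A) m →
    MatchingAvoiding (t ∷ u ∷ A) m ⊎ MatchingAvoiding (t ∷ v ∷ A) m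
  exchange zero    u≢v max M N = inj₁ ∅
  exchange (suc m) {A} {u} {v} {t} u≢v max M N with u ∈? covered N | v ∈? covered N
  ... | no u∉N  | _       = inj₁ (weaken (∈-resp-↭ (swap t u ↭-refl)) (avoid N u∉N))
  ... | yes _   | no v∉N  = inj₂ (weaken (∈-resp-↭ (swap t v ↭-refl)) (avoid N v∉N))
  ... | yes u∈N | yes v∈N with Any.any? (λ x → ¬? (x ∈? t ∷ covered N)) (covered M)
  -- The vertices `u`, `v` and the ends of `M` are distinct, and there is one more of them than
  -- there are entries in `t ∷ covered N`.
  ... | no none = contradiction
    (unique-⊆⇒length-≤ uvM! uvM⊆tN)
    (ℕ.<⇒≱ (ℕ.s≤s (ℕ.s≤s (ℕ.≤-reflexive (trans (length-covered N) (sym (length-covered M)))))))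
    where
    uvM! : Unique (u ∷ v ∷ covered M)
    uvM! = unique-∷ (λ { (here u≡v) → u≢v u≡v ; (there u∈M) → avoids M u∈M (here refl) })
             (unique-∷ (λ v∈M → avoids M v∈M (there (here refl))) (unique M))
    uvM⊆tN : u ∷ v ∷ covered M ⊆ t ∷ covered N
    uvM⊆tN (here refl)         = there u∈N
    uvM⊆tN (there (here refl)) = there v∈N
    uvM⊆tN (there (there x∈M)) = decidable-stable (_ ∈? t ∷ covered N) λ x∉ →
      none (Any.map (λ { refl → x∉ }) x∈M)
  ... | yes some with find some
  ... | x , x∈M , x∉tN with remove M x∈M
  ... | y , x~y , M′ , p with y ∈? covered N
  ... | no y∉N = contradiction
    (insert x~y x∉A y∉A
      (avoid (avoid (weaken there N) y∉N) (x∉tN ∘ there)))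
    max
    where
    x∉A : x ∉ A
    x∉A = avoids M x∈M ∘ there ∘ there
    y∉A : y ∉ A
    y∉A = avoids M (∈-resp-↭ (↭-sym p) (there (here refl))) ∘ there ∘ there
  ... | yes y∈N with remove N y∈N
  ... | z , _ , N′ , q = result (exchange m u≢v max′ M″ N″)
    where
    y∈M : y ∈ covered M
    y∈M = ∈-resp-↭ (↭-sym p) (there (here refl))
    max′ : ¬ MatchingAvoiding (x ∷ y ∷ A) (suc m)
    max′ = max ∘ insert x~y (avoids M x∈M ∘ there ∘ there) (avoids M y∈M ∘ there ∘ there)
    M″ : MatchingAvoiding (u ∷ v ∷ x ∷ y ∷ A) m
    M″ = weaken (∈-resp-↭ (shifts (u ∷ v ∷ []) (x ∷ y ∷ []))) M′
    N″ : MatchingAvoiding (t ∷ x ∷ y ∷ A) m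
    N″ = weaken (λ { (here refl) → there (there (there (here refl)))
                   ; (there (here refl)) → here refl
                   ; (there (there (here refl))) → there (here refl)
                   ; (there (there (there w∈A))) → there (there (there (there w∈A))) })
           (avoid N′ λ x∈N′ → x∉tN (there (∈-resp-↭ (↭-sym q) (there (there x∈N′)))))
    complete : ∀ {w} → w ∈ u ∷ v ∷ A → MatchingAvoiding (t ∷ w ∷ x ∷ y ∷ A) m →
      MatchingAvoiding (t ∷ w ∷ A) (suc m)
    complete {w} w∈ P = insert x~y x∉ y∉ (weaken (∈-resp-↭ (shifts (x ∷ y ∷ []) (t ∷ w ∷ []))) P)
      where
      x∉ : x ∉ t ∷ w ∷ A
      x∉ (here refl)         = x∉tN (here refl)
      x∉ (there (here refl)) = avoids M x∈M w∈
      x∉ (there (there x∈A)) = avoids M x∈M (there (there x∈A))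
      y∉ : y ∉ t ∷ w ∷ A
      y∉ (here refl)         = avoids N y∈N (here refl)
      y∉ (there (here refl)) = avoids M y∈M w∈
      y∉ (there (there y∈A)) = avoids M y∈M (there (there y∈A))
    result : MatchingAvoiding (t ∷ u ∷ x ∷ y ∷ A) m ⊎ MatchingAvoiding (t ∷ v ∷ x ∷ y ∷ A) m →
      MatchingAvoiding (t ∷ u ∷ A) (suc m) ⊎ MatchingAvoiding (t ∷ v ∷ A) (suc m)
    result (inj₁ P) = inj₁ (complete (here refl) P)
    result (inj₂ P) = inj₂ (complete (there (here refl)) P)

  -- The hypothesis of Gallai's lemma for `G - A`, which may be disconnected. The matchings in the
  -- second part are maximum by the first.
  Critical : List (Fin n) → ℕ → Set
  Critical A m = ¬ MatchingAvoiding A (suc m) × (∀ t → t ∉ A → MatchingAvoiding (t ∷ A) m)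

  -- Gallai's lemma: in G − A, being equal or never missed together is transitive.
  walk⇒notMissedTogether : ∀ {A m} → Critical A m → ∀ {u v} → Walk G (toSubset A) u v →
    u ≢ v → ¬ MatchingAvoiding (u ∷ v ∷ A) m
  walk⇒notMissedTogether crit Star.ε u≢u _ = u≢u refl
  walk⇒notMissedTogether {A} {m} crit@(max , missed) {u} {v} (_◅_ {j = t} (u~t , u∉ , t∉) walk) u≢v M
    with t Fin.≟ v
  ... | yes refl = max (insert u~t (u∉ ∘ ∈⇒∈-toSubset) (t∉ ∘ ∈⇒∈-toSubset) M)
  -- The exchange turns a matching missing `u` and `v` into one missing `t` and `u`, which the edge
  -- `ut` would enlarge, or one missing `t` and `v`, where the shorter walk from `t` applies.
  ... | no t≢v with exchange m u≢v max M (missed t (t∉ ∘ ∈⇒∈-toSubset))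
  ... | inj₁ P = max (insert (~-sym u~t) (t∉ ∘ ∈⇒∈-toSubset) (u∉ ∘ ∈⇒∈-toSubset) P)
  ... | inj₂ P = walk⇒notMissedTogether crit walk t≢v P

  -- Moving into `A` a vertex covered by every `m`-matching adds one to `length A` and takes one
  -- from the bound `m` on the matching number, so `length A + m` is preserved. If there is no
  -- `m`-matching at all, only the bound drops. Either way `m` decreases, so the process stops.
  saturate : ∀ m A → ¬ MatchingAvoiding A (suc m) →
    ∃[ B ] ∃[ l ] Critical B l × MatchingAvoiding B l × l ℕ.≤ m × length B ℕ.+ l ℕ.≤ length A ℕ.+ m
  saturate m A max with matchingAvoiding? m A
  saturate zero    A max | no ¬M = contradiction ∅ ¬M
  saturate (suc m) A max | no ¬M with saturate m A ¬M
  ... | B , l , crit , M , l≤m , le = B , l , crit , M , ℕ.m≤n⇒m≤1+n l≤m ,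
    ℕ.≤-trans le (ℕ.+-monoʳ-≤ (length A) (ℕ.n≤1+n m))
  saturate m A max | yes M
    with Fin.any? (λ t → ¬? (t ∈? A) ×-dec ¬? (matchingAvoiding? m (t ∷ A)))
  ... | no none = A , m , (max , missed) , M , ℕ.≤-refl , ℕ.≤-refl
    where
    missed : ∀ t → t ∉ A → MatchingAvoiding (t ∷ A) m
    missed t t∉A = decidable-stable (matchingAvoiding? m (t ∷ A)) λ ¬M → none (t , t∉A , ¬M)
  saturate zero    A max | yes M | yes (_ , _ , ¬M) = contradiction ∅ ¬M
  saturate (suc m) A max | yes M | yes (t , _ , ¬M) with saturate m (t ∷ A) ¬M
  ... | B , l , crit , N , l≤m , le = B , l , crit , N , ℕ.m≤n⇒m≤1+n l≤m ,
    ℕ.≤-trans le (ℕ.≤-reflexive (sym (ℕ.+-suc (length A) m)))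

  -- Vertices missed by a matching, and the counting argument.

  module _ {A m} (M : MatchingAvoiding A m) where

    private
      missed? : ∀ v → Dec (v ∉ A ++ covered M)
      missed? v = ¬? (v ∈? A ++ covered M)

    missed : List (Fin n)
    missed = filter missed? (allFin n)

    ∈-missed⁻ : ∀ {v} → v ∈ missed → v ∉ A × v ∉ covered M
    ∈-missed⁻ v∈ = let v∉ = proj₂ (∈-filter⁻ missed? {xs = allFin n} v∈) in v∉ ∘ ∈-++⁺ˡ , v∉ ∘ ∈-++⁺ʳ A

    -- Equality may fail because `A` may contain repetitions.
    order-≤ : n ℕ.≤ (length A ℕ.+ 2 * m) ℕ.+ length missed
    order-≤ = begin
      n                                              ≡⟨ length-tabulate {n = n} (λ i → i) ⟨
      length (allFin n)                              ≤⟨ unique-⊆⇒length-≤ (Unique.allFin⁺ n) cover ⟩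
      length ((A ++ covered M) ++ missed)            ≡⟨ length-++ (A ++ covered M) ⟩
      length (A ++ covered M) ℕ.+ length missed      ≡⟨ cong (ℕ._+ length missed) (length-++ A) ⟩
      (length A ℕ.+ length (covered M)) ℕ.+ length missed
        ≡⟨ cong (λ l → (length A ℕ.+ l) ℕ.+ length missed) (length-covered M) ⟩
      (length A ℕ.+ 2 * m) ℕ.+ length missed         ∎
      where
      open ℕ.≤-Reasoning
      cover : allFin n ⊆ (A ++ covered M) ++ missed
      cover {v} v∈ with v ∈? A ++ covered M
      ... | yes v∈M = ∈-++⁺ˡ v∈M
      ... | no  v∉M = ∈-++⁺ʳ (A ++ covered M) (∈-filter⁺ missed? v∈ v∉M)

    -- The matching `M` itself misses any two of these vertices together, so Gallai's lemma forbids
    -- a walk between them.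
    missed-apart : Critical A m → AllPairs (λ u v → ¬ Walk G (toSubset A) u v) missed
    missed-apart crit = unique⇒allPairs (Unique.filter⁺ missed? (Unique.allFin⁺ n)) λ u∈ v∈ u≢v walk →
      walk⇒notMissedTogether crit walk u≢v
        (avoid (avoid M (proj₂ (∈-missed⁻ v∈))) (proj₂ (∈-missed⁻ u∈)))

    -- Two missed vertices lie in different components, so `toSubset A` is then a cut. With at most
    -- one missed vertex it need not be one, and a hypothesis about cuts would not apply.
    length-missed : Critical A m →
      length missed ℕ.≤ 1 ⊎ VertexCut G (toSubset A) × length missed ℕ.≤ components G (toSubset A)
    length-missed crit = go missed refl
      where
      S = toSubset A
      ∉S : ∀ {v} → v ∈ missed → v Subset.∉ S
      ∉S v∈ = proj₁ (∈-missed⁻ v∈) ∘ ∈-toSubset⇒∈ A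
      go : ∀ vs → vs ≡ missed → length vs ℕ.≤ 1 ⊎ VertexCut G S × length vs ℕ.≤ components G S
      go []            eq = inj₁ ℕ.z≤n
      go (_ ∷ [])      eq = inj₁ (ℕ.s≤s ℕ.z≤n)
      go (u ∷ v ∷ vs)  eq with subst (AllPairs _) (sym eq) (missed-apart crit)
      ... | apart@((¬uv ∷ _) ∷ _) = inj₂
        ( (λ conn → ¬uv (conn u v (∉S (∈ (here refl))) (∉S (∈ (there (here refl))))))
        , length-≤-components S (∉S ∘ ∈) apart )
        where
        ∈ : ∀ {w} → w ∈ u ∷ v ∷ vs → w ∈ missed
        ∈ = subst (_ ∈_) eq

  -- In the absence of the matching, saturation and the count of missed vertices give
  -- `n ≤ length A + 2 * m + 1` in the successor case, whereas `n` is `length A + 2 * m + 2`. The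
  -- even difference between `n` and `length A` thus absorbs the extra one that the hypothesis
  -- allows.
  matching-of-few-components : ∀ A → (∀ S → VertexCut G S → components G S ℕ.+ length A ℕ.≤ suc ∣ S ∣) →
    ∀ m → n ≡ length A ℕ.+ 2 * m → MatchingAvoiding A m
  matching-of-few-components A few zero    _  = ∅
  matching-of-few-components A few (suc m) n≡ = decidable-stable (matchingAvoiding? (suc m) A) λ max →
    let B , l , crit , M , l≤m , le = saturate m A max in
    ℕ.<⇒≱ (ℕ.≤-reflexive (sym n≡′)) (bound B l M l≤m le (length-missed M crit))
    where
    a = length A
    n≡′ : n ≡ suc (suc (a ℕ.+ 2 * m))
    n≡′ = trans n≡ (trans (cong (a ℕ.+_) (ℕ.*-suc 2 m)) (trans (ℕ.+-suc a _) (cong suc (ℕ.+-suc a _))))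
    open ℕ.≤-Reasoning
    bound : ∀ B l (M : MatchingAvoiding B l) → l ℕ.≤ m → length B ℕ.+ l ℕ.≤ a ℕ.+ m →
      length (missed M) ℕ.≤ 1 ⊎
        VertexCut G (toSubset B) × length (missed M) ℕ.≤ components G (toSubset B) →
      n ℕ.≤ suc (a ℕ.+ 2 * m)
    bound B l M l≤m le (inj₁ few-missed) = begin
      n                                     ≤⟨ order-≤ M ⟩
      (b ℕ.+ 2 * l) ℕ.+ length (missed M)   ≤⟨ ℕ.+-mono-≤ b+2l≤ few-missed ⟩
      (a ℕ.+ 2 * m) ℕ.+ 1                   ≡⟨ ℕ.+-comm _ 1 ⟩
      suc (a ℕ.+ 2 * m)                     ∎
      where
      b = length B
      b+2l≤ : b ℕ.+ 2 * l ℕ.≤ a ℕ.+ 2 * m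
      b+2l≤ = begin
        b ℕ.+ 2 * l            ≡⟨ rearrange b l ⟩
        (b ℕ.+ l) ℕ.+ l        ≤⟨ ℕ.+-mono-≤ le l≤m ⟩
        (a ℕ.+ m) ℕ.+ m        ≡⟨ rearrange a m ⟨
        a ℕ.+ 2 * m            ∎
        where
        rearrange : ∀ b l → b ℕ.+ 2 * l ≡ (b ℕ.+ l) ℕ.+ l
        rearrange = solve-∀
    -- Adding `a` on both sides lets `few` trade the components for `b + 1`. The total becomes
    -- `2 * (b + l) + 1`, which the saturation bound controls.
    bound B l M l≤m le (inj₂ (cut , few-missed)) = ℕ.+-cancelʳ-≤ a _ _ (begin
      n ℕ.+ a                                        ≤⟨ ℕ.+-monoˡ-≤ a (order-≤ M) ⟩
      (b ℕ.+ 2 * l) ℕ.+ length (missed M) ℕ.+ a      ≤⟨ ℕ.+-monoˡ-≤ a (ℕ.+-monoʳ-≤ (b ℕ.+ 2 * l) few-missed) ⟩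
      (b ℕ.+ 2 * l) ℕ.+ c ℕ.+ a                      ≡⟨ ℕ.+-assoc (b ℕ.+ 2 * l) c a ⟩
      (b ℕ.+ 2 * l) ℕ.+ (c ℕ.+ a)                    ≤⟨ ℕ.+-monoʳ-≤ (b ℕ.+ 2 * l) (few (toSubset B) cut) ⟩
      (b ℕ.+ 2 * l) ℕ.+ suc ∣ toSubset B ∣           ≤⟨ ℕ.+-monoʳ-≤ (b ℕ.+ 2 * l) (ℕ.s≤s (∣toSubset∣≤length B)) ⟩
      (b ℕ.+ 2 * l) ℕ.+ suc b                        ≡⟨ rearrange₁ b l ⟩
      suc (2 * (b ℕ.+ l))                            ≤⟨ ℕ.s≤s (ℕ.*-monoʳ-≤ 2 le) ⟩
      suc (2 * (a ℕ.+ m))                            ≡⟨ rearrange₂ a m ⟩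
      suc (a ℕ.+ 2 * m) ℕ.+ a                        ∎)
      where
      b = length B
      c = components G (toSubset B)
      rearrange₁ : ∀ b l → (b ℕ.+ 2 * l) ℕ.+ suc b ≡ suc (2 * (b ℕ.+ l))
      rearrange₁ = solve-∀
      rearrange₂ : ∀ a m → suc (2 * (a ℕ.+ m)) ≡ suc (a ℕ.+ 2 * m) ℕ.+ a
      rearrange₂ = solve-∀

  -- Matchings as lists of edges and their extension.

  Any-isEndOf⁺ : ∀ M {v} → v ∈ ends M → Any (λ e → _IsEndOf_ G v e) M
  Any-isEndOf⁺ (_ ∷ M) (here v≡u)         = here (inj₁ v≡u)
  Any-isEndOf⁺ (_ ∷ M) (there (here v≡w)) = here (inj₂ v≡w)
  Any-isEndOf⁺ (_ ∷ M) (there (there v∈)) = there (Any-isEndOf⁺ M v∈)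

  Any-isEndOf⁻ : ∀ {M v} → Any (λ e → _IsEndOf_ G v e) M → v ∈ ends M
  Any-isEndOf⁻ (here (inj₁ v≡u)) = here v≡u
  Any-isEndOf⁻ (here (inj₂ v≡w)) = there (here v≡w)
  Any-isEndOf⁻ (there v∈)        = there (there (Any-isEndOf⁻ v∈))

  isMatching⇒unique : ∀ {M} → IsMatching G M → Unique (ends M)
  isMatching⇒unique []                               = []
  isMatching⇒unique {((u , v) , u~v) ∷ M} (ind ∷ M!) =
    unique-∷ (λ { (here u≡v) → ~-irrefl u≡v u~v ; (there u∈M) → apart (inj₁ refl) u∈M })
      (unique-∷ (apart (inj₂ refl)) (isMatching⇒unique M!))
    where
    apart : ∀ {w} → _IsEndOf_ G w ((u , v) , u~v) → w ∉ ends M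
    apart w-end w∈M = All.lookupWith (λ ind′ w-end′ → ind′ _ (w-end , w-end′)) ind (Any-isEndOf⁺ M w∈M)

  unique⇒isMatching : ∀ M → Unique (ends M) → IsMatching G M
  unique⇒isMatching []      _                             = []
  unique⇒isMatching (e ∷ M) ((_ ∷ u∉M) ∷ v∉M ∷ M!) =
    All.tabulate (λ e′∈M w (w-end , w-end′) → apart w-end (Any-isEndOf⁻ (Any.map (λ { refl → w-end′ }) e′∈M))) ∷
    unique⇒isMatching M M!
    where
    apart : ∀ {w} → _IsEndOf_ G w e → w ∉ ends M
    apart (inj₁ refl) w∈M = All.lookup u∉M w∈M refl
    apart (inj₂ refl) w∈M = All.lookup v∉M w∈M refl

  ends-++ : ∀ M N → ends (M ++ N) ≡ ends M ++ ends N
  ends-++ []      N = refl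
  ends-++ (_ ∷ M) N = cong (λ us → _ ∷ _ ∷ us) (ends-++ M N)

  -- A perfect matching of `G` without the ends of `M` is appended to `M`; the result has `n`
  -- distinct ends, hence covers every vertex. Allowing fewer than `k` edges lets the empty matching
  -- supply a perfect matching of `G`.
  extend-matching : ∀ k → 2 ∣ n → (∀ S → VertexCut G S → components G S ℕ.+ 2 * k ℕ.≤ suc ∣ S ∣) →
    ∀ M → IsMatching G M → length M ℕ.≤ k → ∃[ P ] IsPerfectMatching G P × _ContainedIn_ G M P
  extend-matching k (divides q n≡q*2) few M M-matching |M|≤k =
    P , (unique⇒isMatching P P! , λ v → Any-isEndOf⁺ P (unique-length⇒∈ P! |P|≡n v)) ,
    All.tabulate λ e∈M → Any.map (λ { refl w → (λ h → h) , (λ h → h) }) (∈-++⁺ˡ e∈M)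
    where
    A = ends M
    A! = isMatching⇒unique M-matching
    j = length M
    n≡2q : n ≡ 2 * q
    n≡2q = trans n≡q*2 (ℕ.*-comm q 2)
    j≤q : j ℕ.≤ q
    j≤q = ℕ.*-cancelˡ-≤ 2 (ℕ.≤-trans (ℕ.≤-reflexive (sym (length-ends M)))
      (ℕ.≤-trans (unique⇒length-≤ A!) (ℕ.≤-reflexive n≡2q)))
    n≡ : n ≡ length A ℕ.+ 2 * (q ∸ j)
    n≡ = begin
      n                           ≡⟨ n≡2q ⟩
      2 * q                       ≡⟨ cong (2 *_) (ℕ.m+[n∸m]≡n j≤q) ⟨
      2 * (j ℕ.+ (q ∸ j))         ≡⟨ ℕ.*-distribˡ-+ 2 j (q ∸ j) ⟩
      2 * j ℕ.+ 2 * (q ∸ j)       ≡⟨ cong (ℕ._+ 2 * (q ∸ j)) (length-ends M) ⟨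
      length A ℕ.+ 2 * (q ∸ j)    ∎
      where open ≡-Reasoning
    N : MatchingAvoiding A (q ∸ j)
    N = matching-of-few-components A
      (λ S cut → ℕ.≤-trans
        (ℕ.+-monoʳ-≤ (components G S) (ℕ.≤-trans (ℕ.≤-reflexive (length-ends M)) (ℕ.*-monoʳ-≤ 2 |M|≤k)))
        (few S cut))
      (q ∸ j) n≡
    P = M ++ edges N
    P! : Unique (ends P)
    P! = subst Unique (sym (ends-++ M (edges N)))
      (Unique.++⁺ A! (unique N) λ (w∈A , w∈N) → avoids N w∈N w∈A)
    |P|≡n : length (ends P) ≡ n
    |P|≡n = begin
      length (ends P)                     ≡⟨ cong length (ends-++ M (edges N)) ⟩
      length (A ++ covered N)             ≡⟨ length-++ A ⟩
      length A ℕ.+ length (covered N)     ≡⟨ cong (length A ℕ.+_) (length-covered N) ⟩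
      length A ℕ.+ 2 * (q ∸ j)            ≡⟨ n≡ ⟨
      n                                   ∎
      where open ≡-Reasoning

  vertexCut⇒∣S∣<n : ∀ {S} → VertexCut G S → ∣ S ∣ ℕ.< n
  vertexCut⇒∣S∣<n {S} cut = ℕ.≤∧≢⇒< (Subset.∣p∣≤n S) λ ∣S∣≡n → cut λ u _ u∉S _ →
    contradiction (subst (u Subset.∈_) (sym (Subset.∣p∣≡n⇒p≡⊤ ∣S∣≡n)) Subset.∈⊤) u∉S

  -- A non-complete graph has a vertex cut `S`, and `components G S ≥ 1` gives `2 * k ≤ ∣ S ∣ < n`.
  -- As `n` is even, the strict inequality improves to a gap of two.
  order-bound : ∀ k → ¬ Complete G → 2 ∣ n →
    (∀ S → VertexCut G S → components G S ℕ.+ 2 * k ℕ.≤ suc ∣ S ∣) → 2 * k ℕ.+ 2 ℕ.≤ n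
  order-bound k nc (divides q n≡q*2) few = begin
    2 * k ℕ.+ 2    ≡⟨ ℕ.+-comm (2 * k) 2 ⟩
    2 ℕ.+ 2 * k    ≡⟨ ℕ.*-suc 2 k ⟨
    2 * suc k      ≤⟨ ℕ.*-monoʳ-≤ 2 (ℕ.*-cancelˡ-< 2 k q 2k<2q) ⟩
    2 * q          ≡⟨ ℕ.*-comm 2 q ⟩
    q * 2          ≡⟨ n≡q*2 ⟨
    n              ∎
    where
    open ℕ.≤-Reasoning
    2k<n : ∃ (VertexCut G) → 2 * k ℕ.< n
    2k<n (S , cut) = begin-strict
      2 * k     ≤⟨ ℕ.s≤s⁻¹ (ℕ.≤-trans
                     (ℕ.+-monoˡ-≤ (2 * k) (ℕ.>-nonZero⁻¹ (components G S) {{components-nonZero G cut}}))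
                     (few S cut)) ⟩
      ∣ S ∣     <⟨ vertexCut⇒∣S∣<n cut ⟩
      n         ∎
    2k<2q : 2 * k ℕ.< 2 * q
    2k<2q = subst (2 * k ℕ.<_) (trans n≡q*2 (ℕ.*-comm q 2)) (2k<n (∃-vertexCut G nc))

corollary3p2 : (k : ℕ) → .{{_ : NonZero k}} →
    (ε : ℝ) (ε>0 : 0ℝ <ℝ ε) →
    (n : ℕ) (G : Graph n) →
    Connected G →
    (nc : ¬ (Complete G)) →
    2 ∣ n →
    1ℝ +ℝ ε ≤ℝ fromℚ (toughness G nc) →
    (fromℕ (2 * k ∸ 2) *ℝ (1ℝ +ℝ ε)) ÷ℝ ε [ ε>0 ] <ℝ fromℕ (κ G) →
    Extendable G k
corollary3p2 k ε ε>0 n G connected nc even tough κ-large =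
  connected ,
  (let P , P-perfect , _ = extend-matching G k even few [] [] ℕ.z≤n in P , P-perfect) ,
  order-bound G k nc even few ,
  λ M M-matching |M|≡k → extend-matching G k even few M M-matching (ℕ.≤-reflexive |M|≡k)
  where
  few : ∀ S → VertexCut G S → components G S ℕ.+ 2 * k ℕ.≤ suc ∣ S ∣
  few S cut = begin
    -- Truncated subtraction does no harm: `2 * k ≤ 2 + (2 * k ∸ 2)` always holds.
    c ℕ.+ 2 * k                  ≤⟨ ℕ.+-monoʳ-≤ c (ℕ.m≤n+m∸n (2 * k) 2) ⟩
    c ℕ.+ (2 ℕ.+ (2 * k ∸ 2))    ≡⟨ rearrange c (2 * k ∸ 2) ⟩
    suc (suc (2 * k ∸ 2 ℕ.+ c))  ≤⟨ ℕ.s≤s (cut-bound (2 * k ∸ 2) ε ε>0 G nc tough κ-large S cut) ⟩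
    suc ∣ S ∣                    ∎
    where
    open ℕ.≤-Reasoning
    c = components G S
    rearrange : ∀ c K → c ℕ.+ (2 ℕ.+ K) ≡ suc (suc (K ℕ.+ c))
    rearrange = solve-∀
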